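{- There exists an absolute constant $c>0$ such that for every positive integer $d$ and every sufficiently large $n$ (depending on $d$) there exists a $d$-regular bipartite graph with $n$ vertices on each side that is an $\alpha$-multitasker for some $\alpha\in(0,1]$ with $\alpha\ge c\,\frac{\log d}{d}$.
   Context: Graphs are finite and simple. A matching is a set of edges no two of which share a vertex. A matching $M'$ in $G$ is induced if no two distinct edges of $M'$ are joined by an edge of $G$. A bipartite graph $G$ with $n$ vertices on each side is an $\alpha$-multitasker if every matching $M$ in $G$ (of any size $k=1,\dots,n$) contains a matching $M'\subseteq M$ that is induced in $G$ with $|M'|\ge\alpha|M|$. -}

module Defs where

open import Data.Bool using (Bool; T)
open import Data.Fin using (Fin)
open import Data.Fin.Subset using (∣_∣)
open import Data.Integer using (+_; -[1+_])
open import Data.List using (List; length)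
open import Data.List.Membership.Propositional using (_∈_)
open import Data.List.Relation.Binary.Subset.Propositional using (_⊆_)
open import Data.List.Relation.Unary.All using (All)
open import Data.List.Relation.Unary.AllPairs using (AllPairs)
open import Data.Nat as ℕ using (ℕ; suc; NonZero)
open import Data.Product using (_×_; _,_; ∃-syntax)
open import Data.Rational as ℚ using (ℚ; ↥_; ↧ₙ_)
open import Data.Sum using (_⊎_)
open import Data.Vec using (tabulate)
open import Relation.Binary.PropositionalEquality using (_≡_; _≢_)
open import Relation.Nullary using (¬_)

-- A (finite, simple) bipartite graph with n vertices on each side, given by
-- its biadjacency matrix: `adj u v` says whether the left vertex u and the
-- right vertex v are adjacent.  Vertices on the same side are never adjacent.
record BipartiteGraph (n : ℕ) : Set where
  field
    adj : Fin n → Fin n → Bool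

  -- (left endpoint , right endpoint)
  Pair : Set
  Pair = Fin n × Fin n

  IsEdge : Pair → Set
  IsEdge (u , v) = T (adj u v)

  degreeˡ : Fin n → ℕ
  degreeˡ u = ∣ tabulate (λ v → adj u v) ∣

  degreeʳ : Fin n → ℕ
  degreeʳ v = ∣ tabulate (λ u → adj u v) ∣

  Regular : ℕ → Set
  Regular d = (∀ u → degreeˡ u ≡ d) × (∀ v → degreeʳ v ≡ d)

  VertexDisjoint : Pair → Pair → Set
  VertexDisjoint (u , v) (u′ , v′) = u ≢ u′ × v ≢ v′

  -- A set of edges is a list of edges; the pairwise condition rules out
  -- repetitions, so the length of a matching is its cardinality.
  IsMatching : List Pair → Set
  IsMatching M = All IsEdge M × AllPairs VertexDisjoint M

  -- Some edge of the graph has one endpoint on each of the two given edges.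
  Joined : Pair → Pair → Set
  Joined (u , v) (u′ , v′) = IsEdge (u , v′) ⊎ IsEdge (u′ , v)

  IsInduced : List Pair → Set
  IsInduced M = ∀ {e f} → e ∈ M → f ∈ M → e ≢ f → ¬ Joined e f

  IsMultitasker : ℚ → Set
  IsMultitasker α =
    ∀ (M : List Pair) → IsMatching M →
    ∃[ M′ ] M′ ⊆ M × IsMatching M′ × IsInduced M′ ×
      (+ length M′ ℚ./ 1) ℚ.≥ α ℚ.* (+ length M ℚ./ 1)

open BipartiteGraph public using (Regular; IsMultitasker)

-- r ≤log₂ d  means  r ≤ log₂ d,  that is  2^r ≤ d.  For r = a / b in lowest
-- terms this is  2^a ≤ d^b,  with negative powers of 2 moved to the right.
_≤log₂_ : ℚ → ℕ → Set
r ≤log₂ d with ↥ r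
... | + a      = 2 ℕ.^ a ℕ.≤ d ℕ.^ ↧ₙ r
... | -[1+ a ] = 1 ℕ.≤ d ℕ.^ ↧ₙ r ℕ.* 2 ℕ.^ suc a

-- α ≥ c · (log₂ d) / d,  for c ≥ 0.  The real number log₂ d is the supremum of
-- the rationals r ≤ log₂ d, so the inequality says that α is an upper bound
-- of the numbers c · r / d.  The base 2 only affects the constant c.
_≥_·log₂_/self : ℚ → ℚ → (d : ℕ) → .{{_ : NonZero d}} → Set
α ≥ c ·log₂ d /self = ∀ r → r ≤log₂ d → α ℚ.≥ c ℚ.* (r ℚ.* (+ 1 ℚ./ d))

{-# OPTIONS --safe #-}

module Submission where

import Algebra.Properties.CommutativeMonoid.Sum as CommutativeMonoidSum
import Algebra.Properties.CommutativeSemigroup as CommutativeSemigroup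
open import Data.Bool using (Bool; true; false; _∧_; _∨_; not; T; if_then_else_)
open import Data.Bool.Properties using (∧-assoc; ∨-comm; T-≡; T-∨)
open import Data.Fin using (Fin; zero; suc; _≟_)
open import Data.Fin.Properties using (any?; injective⇒≤)
open import Data.Fin.Subset using (∣_∣)
import Data.Integer as ℤ
import Data.Integer.Properties as ℤ
open import Data.List using (List; []; _∷_; _++_; length; map; concatMap; null)
import Data.List.Membership.DecPropositional as DecMembership
open import Data.List.Membership.Propositional using (_∈_)
open import Data.List.Membership.Propositional.Properties using (∈-∃++; ∈-map⁺; ∈-++⁺ˡ; ∈-++⁺ʳ; ∈-concatMap⁺)
open import Data.List.Properties using (length-map; length-++; map-∘; map-cong-local)
open import Data.List.Relation.Binary.Permutation.Propositional using (_↭_; prep; swap; ↭-trans; ↭-sym)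
open import Data.List.Relation.Binary.Permutation.Propositional.Properties as ↭ using (shift)
open import Data.List.Relation.Binary.Sublist.Propositional using ([]; _∷_; _∷ʳ_; minimum; lookup) renaming (_⊆_ to _⊑_)
open import Data.List.Relation.Binary.Sublist.Propositional.Properties using (All-resp-⊆)
open import Data.List.Relation.Unary.All as All using (All; []; _∷_)
open import Data.List.Relation.Unary.AllPairs as AllPairs using (AllPairs; []; _∷_)
import Data.List.Relation.Unary.AllPairs.Properties as AllPairs
open import Data.List.Relation.Unary.Any as Any using (here; there)
import Data.List.Relation.Unary.Any.Properties as Any
open import Data.Nat using (ℕ; zero; suc; _+_; _*_; _^_; _≤_; _<_; _≥_; z≤n; s≤s; _≤?_; _<?_; NonZero; >-nonZero)
import Data.Nat.ListAction as List
open import Data.Nat.ListAction.Properties using (sum-↭)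
open import Data.Nat.Properties hiding (_≟_)
open import Data.Nat.Tactic.RingSolver using (solve-∀)
open import Data.Product using (_×_; _,_; ∃₂; ∃-syntax; Σ-syntax; proj₁; proj₂)
import Data.Product.Properties as Product
open import Data.Rational as ℚ using (ℚ; mkℚ; 0ℚ; 1ℚ; toℚᵘ)
import Data.Rational.Properties as ℚ
open import Data.Rational.Unnormalised as ℚᵘ using (mkℚᵘ; _≃_; *≡*; *≤*; *<*)
import Data.Rational.Unnormalised.Properties as ℚᵘ
open import Data.Sum using (_⊎_; inj₁; inj₂; [_,_]′)
import Data.Sum.Properties as Sum
open import Data.Unit using (⊤; tt)
open import Data.Vec using (tabulate)
open import Data.Vec.Functional using (updateAt)
open import Data.Vec.Functional.Properties using (updateAt-updates; updateAt-minimal)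
open import Function using (_∘_; const; flip; Equivalence)
open import Level using (0ℓ)
open import Relation.Binary using (Rel; Symmetric; _⇒_)
open import Relation.Binary.Construct.Union using (_∪_)
open import Relation.Binary.PropositionalEquality using (_≡_; _≢_; refl; sym; trans; cong; cong₂; subst; subst₂)
open import Relation.Nullary using (¬_; Dec; yes; no; contradiction; ¬?; does)
open import Relation.Nullary.Decidable using (dec-true; dec-false)
open import Defs

open CommutativeMonoidSum +-0-commutativeMonoid using (sum; ∑-comm; sum-cong-≗; sum-replicate-zero)
open CommutativeSemigroup +-commutativeSemigroup using (interchange; x∙yz≈y∙xz)

-- The graph is built edge by edge as by Erdős and Sachs, keeping the girth at
-- least 8 and all degrees at most d: as long as some left and right vertices have
-- degree below d, an edge is added, or a remote edge is traded for two new ones.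
--
-- In a bipartite graph without 4- and 6-cycles the conflict graph of a matching
-- (its edges, adjacent when joined) is triangle-free, and its degrees are at
-- most 2d.  A uniformly random independent set W of such a graph has expected size
-- of order log d / d times the number of vertices: give each vertex v the
-- weight D [v ∈ W] + |W ∩ N(v)| for D = 8d.  Conditionally on W outside of
-- {v} ∪ N(v), with x neighbours of v still free, the 2^x + 1 completions have
-- total weight D + x 2^(x-1), which is at least L (2^x + 1) when D ≥ 8^L.
-- The total weight is at most 2D |W|, so some W has at least L / 16d times
-- as many elements as the matching.

-- Walks, and the girth of a relation with one added edge.

module _ {V : Set} where

  private variable
    E F : Rel V 0ℓ
    i j k l : ℕ
    s t w x y : V

  -- The index is an upper bound for the length, not the length itself.
  data Walk (E : Rel V 0ℓ) : ℕ → V → V → Set where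
    here : Walk E k s s
    step : E s t → Walk E k t w → Walk E (suc k) s w

  Link : V → V → Rel V 0ℓ
  Link x y s t = (s ≡ x × t ≡ y) ⊎ (s ≡ y × t ≡ x)

  Link-flip : Link x y s t → Link y x s t
  Link-flip (inj₁ l) = inj₂ l
  Link-flip (inj₂ l) = inj₁ l

  infixl 6 _∖_,_
  _∖_,_ : Rel V 0ℓ → V → V → Rel V 0ℓ
  (E ∖ x , y) s t = E s t × ¬ Link x y s t

  -- No edge lies on a cycle of length at most suc g.
  GirthAbove : ℕ → Rel V 0ℓ → Set
  GirthAbove g E = ∀ {x y} → E x y → ¬ Walk (E ∖ x , y) g x y

  weaken : k ≤ l → Walk E k s t → Walk E l s t
  weaken _         here       = here
  weaken (s≤s k≤l) (step e p) = step e (weaken k≤l p)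

  map-walk : E ⇒ F → Walk E k s t → Walk F k s t
  map-walk f here       = here
  map-walk f (step e p) = step (f e) (map-walk f p)

  _◅◅_ : Walk E i s t → Walk E j t w → Walk E (i + j) s w
  here     ◅◅ q = weaken (m≤n+m _ _) q
  step e p ◅◅ q = step e (p ◅◅ q)

  reverse-walk : Symmetric E → Walk E k s t → Walk E k t s
  reverse-walk E-sym here = here
  reverse-walk E-sym (step {k = k} e p) =
    weaken (≤-reflexive (+-comm k 1)) (reverse-walk E-sym p ◅◅ step (E-sym e) here)

  -- A walk that crosses a new link exactly once, from `x` to `y`; the crossing counts as one step
  -- of the bound `k`.
  Via : Rel V 0ℓ → V → V → ℕ → V → V → Set
  Via E x y k s t = ∃₂ λ i j → i + suc j ≤ k × Walk E i s x × Walk E j y t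

  via-step : E s t → Via E x y k t w → Via E x y (suc k) s w
  via-step e (i , j , ij , p , q) = suc i , j , s≤s ij , step e p , q

  -- Detours are cut out by induction on the walk. If the walk crosses the link and later does so
  -- again in the same direction, only the part after the later crossing is kept; if it crosses
  -- back, it is again where it began, and both crossings are dropped.
  splice : Walk (E ∪ Link x y) k s t → Walk E k s t ⊎ Via E x y k s t ⊎ Via E y x k s t
  splice here = inj₁ here
  splice (step (inj₁ e) p) with splice p
  ... | inj₁ q        = inj₁ (step e q)
  ... | inj₂ (inj₁ q) = inj₂ (inj₁ (via-step e q))
  ... | inj₂ (inj₂ q) = inj₂ (inj₂ (via-step e q))
  splice (step (inj₂ (inj₁ (refl , refl))) p) with splice p
  ... | inj₁ q                              = inj₂ (inj₁ (0 , _ , ≤-refl , here , q))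
  ... | inj₂ (inj₁ (i , j , ij , _ , q))    = inj₂ (inj₁ (0 , j , m≤n⇒m≤1+n (m+n≤o⇒n≤o i ij) , here , q))
  ... | inj₂ (inj₂ (i , j , ij , _ , q))    = inj₁ (weaken (≤-trans (n≤1+n _) (m≤n⇒m≤1+n (m+n≤o⇒n≤o i ij))) q)
  splice (step (inj₂ (inj₂ (refl , refl))) p) with splice p
  ... | inj₁ q                              = inj₂ (inj₂ (0 , _ , ≤-refl , here , q))
  ... | inj₂ (inj₂ (i , j , ij , _ , q))    = inj₂ (inj₂ (0 , j , m≤n⇒m≤1+n (m+n≤o⇒n≤o i ij) , here , q))
  ... | inj₂ (inj₁ (i , j , ij , _ , q))    = inj₁ (weaken (≤-trans (n≤1+n _) (m≤n⇒m≤1+n (m+n≤o⇒n≤o i ij))) q)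

  girth-⊆ : ∀ {g} → E ⇒ F → GirthAbove g F → GirthAbove g E
  girth-⊆ f girth e p = girth (f e) (map-walk (λ (e , ¬l) → f e , ¬l) p)

  restore : Walk (E ∖ x , y) k s t → Walk E k s t
  restore {E = E} {x} {y} = map-walk {E = E ∖ x , y} {F = E} (λ (e , _) → e)

  -- A short cycle through the new edge would leave a short walk between `x` and `y` in `E`. A short
  -- cycle through an old edge `s t` that uses the new one leaves two walks from the ends of `s t`
  -- to `x` and `y`; with `s t` between them they form a walk from `x` to `y` within length `g`.
  girth-add : ∀ {g} → Symmetric E → GirthAbove g E → ¬ Walk E g x y → GirthAbove g (E ∪ Link x y)
  girth-add {E = E} {x} {y} E-sym girth far {s} {t} (inj₂ l) p with l
  ... | inj₁ (refl , refl) = far (map-walk drop p)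
    where
    drop : ((E ∪ Link x y) ∖ x , y) ⇒ E
    drop (inj₁ e , _)  = e
    drop (inj₂ l , ¬l) = contradiction l ¬l
  ... | inj₂ (refl , refl) = far (reverse-walk E-sym (map-walk drop p))
    where
    drop : ((E ∪ Link x y) ∖ y , x) ⇒ E
    drop (inj₁ e , _)  = e
    drop (inj₂ l , ¬l) = contradiction (Link-flip l) ¬l
  girth-add {E = E} {x} {y} E-sym girth far {s} {t} (inj₁ e) p with splice (map-walk regroup p)
    where
    regroup : ((E ∪ Link x y) ∖ s , t) ⇒ ((E ∖ s , t) ∪ Link x y)
    regroup (inj₁ e , ¬l) = inj₁ (e , ¬l)
    regroup (inj₂ l , _)  = inj₂ l
  ... | inj₁ q = girth e q
  ... | inj₂ (inj₁ (i , j , ij , q , r)) =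
    far (weaken ij (reverse-walk E-sym (restore q)
                    ◅◅ step e (reverse-walk E-sym (restore r))))
  ... | inj₂ (inj₂ (i , j , ij , q , r)) =
    far (weaken (≤-trans (≤-reflexive (trans (+-suc j i) (trans (cong suc (+-comm j i)) (sym (+-suc i j))))) ij)
      (restore r ◅◅ step (E-sym e) (restore q)))

-- Sums over finite index sets.

⟦_⟧ : Bool → ℕ
⟦ true ⟧  = 1
⟦ false ⟧ = 0

∣tabulate∣≡sum : ∀ {n} (f : Fin n → Bool) → ∣ tabulate f ∣ ≡ sum (⟦_⟧ ∘ f)
∣tabulate∣≡sum {zero}  f = refl
∣tabulate∣≡sum {suc n} f with f zero
... | true  = cong suc (∣tabulate∣≡sum (f ∘ suc))
... | false = ∣tabulate∣≡sum (f ∘ suc)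

sum-increase : ∀ {n a} {f g : Fin n → ℕ} i → g i ≡ a + f i → (∀ j → j ≢ i → g j ≡ f j) →
               sum g ≡ a + sum f
sum-increase {a = a} {f} zero gi off =
  trans (cong₂ _+_ gi (sum-cong-≗ (λ j → off (suc j) λ ()))) (+-assoc a (f zero) _)
sum-increase {a = a} {f} (suc i) gi off =
  trans (cong₂ _+_ (off zero λ ()) (sum-increase i gi (λ j j≢i → off (suc j) λ { refl → j≢i refl })))
        (x∙yz≈y∙xz (f zero) a _)

sum-deficient : ∀ {n d} (f : Fin n → ℕ) → sum f < n * d → ∃[ i ] f i < d
sum-deficient {suc n} {d} f lt with f zero <? d
... | yes f₀<d = zero , f₀<d
... | no  f₀≮d =
  let i , fi<d = sum-deficient (f ∘ suc) (+-cancelˡ-< d _ _ (≤-<-trans (+-monoˡ-≤ _ (≮⇒≥ f₀≮d)) lt))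
  in suc i , fi<d

sum-≤ : ∀ {n d} (f : Fin n → ℕ) → (∀ i → f i ≤ d) → sum f ≤ n * d
sum-≤ {zero}  f f≤d = z≤n
sum-≤ {suc n} f f≤d = +-mono-≤ (f≤d zero) (sum-≤ (f ∘ suc) (f≤d ∘ suc))

-- If one term fell short, the others could not make up for it. Regularity of the final graph is
-- read off from its edge count in this way.
sum-saturated : ∀ {n d} (f : Fin n → ℕ) → (∀ i → f i ≤ d) → n * d ≤ sum f → ∀ i → f i ≡ d
sum-saturated {suc n} {d} f f≤d ge zero =
  ≤-antisym (f≤d zero)
    (+-cancelʳ-≤ (n * d) _ _ (≤-trans ge (+-monoʳ-≤ _ (sum-≤ (f ∘ suc) (f≤d ∘ suc)))))
sum-saturated {suc n} {d} f f≤d ge (suc i) =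
  sum-saturated (f ∘ suc) (f≤d ∘ suc) (+-cancelˡ-≤ d _ _ (≤-trans ge (+-monoˡ-≤ _ (f≤d zero)))) i

trues : ∀ {n} → (Fin n → Bool) → List (Fin n)
trues {zero}  f = []
trues {suc n} f = if f zero then zero ∷ rest else rest
  where rest = map suc (trues (f ∘ suc))

length-trues : ∀ {n} (f : Fin n → Bool) → length (trues f) ≡ sum (⟦_⟧ ∘ f)
length-trues {zero}  f = refl
length-trues {suc n} f with f zero
... | true  = cong suc (trans (length-map suc (trues (f ∘ suc))) (length-trues (f ∘ suc)))
... | false = trans (length-map suc (trues (f ∘ suc))) (length-trues (f ∘ suc))

∈-trues : ∀ {n} (f : Fin n → Bool) {i} → T (f i) → i ∈ trues f
∈-trues {suc n} f {zero} fi with f zero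
... | true = here refl
∈-trues {suc n} f {suc i} fi with f zero
... | true  = there (∈-map⁺ suc (∈-trues (f ∘ suc) fi))
... | false = ∈-map⁺ suc (∈-trues (f ∘ suc) fi)

-- Biadjacency matrices and the insertion of an edge.

Matrix : ℕ → Set
Matrix n = Fin n → Fin n → Bool

Vertex : ℕ → Set
Vertex n = Fin n ⊎ Fin n

data Edge {n : ℕ} (A : Matrix n) : Rel (Vertex n) 0ℓ where
  lr : ∀ {u v} → T (A u v) → Edge A (inj₁ u) (inj₂ v)
  rl : ∀ {u v} → T (A u v) → Edge A (inj₂ v) (inj₁ u)

private variable
  n d : ℕ
  A B : Matrix n
  u v x y : Fin n

Edge-sym : Symmetric (Edge A)
Edge-sym (lr e) = rl e
Edge-sym (rl e) = lr e

rowSum : Matrix n → Fin n → ℕ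
rowSum A u = sum (λ v → ⟦ A u v ⟧)

total : Matrix n → ℕ
total A = sum (rowSum A)

total-flip : (A : Matrix n) → total (flip A) ≡ total A
total-flip A = ∑-comm (λ v u → ⟦ A u v ⟧)

-- A relation between matrices instead of an operation: from `A` to `B` it adds an edge, from `B` to
-- `A` it deletes one, and the same lemmas serve both.
record Inserts (A : Matrix n) (x y : Fin n) (B : Matrix n) : Set where
  field
    before : A x y ≡ false
    after  : B x y ≡ true
    others : ∀ i j → i ≢ x ⊎ j ≢ y → B i j ≡ A i j
open Inserts

inserts-flip : Inserts A x y B → Inserts (flip A) y x (flip B)
inserts-flip ins .before = ins .before
inserts-flip ins .after  = ins .after
inserts-flip ins .others i j (inj₁ i≢y) = ins .others j i (inj₂ i≢y)
inserts-flip ins .others i j (inj₂ j≢x) = ins .others j i (inj₁ j≢x)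

rowSum-suc : Inserts A x y B → rowSum B x ≡ suc (rowSum A x)
rowSum-suc {x = x} {y} ins =
  sum-increase y (trans (cong ⟦_⟧ (ins .after)) (cong (suc ∘ ⟦_⟧) (sym (ins .before))))
    (λ j j≢y → cong ⟦_⟧ (ins .others x j (inj₂ j≢y)))

rowSum-other : Inserts A x y B → ∀ {i} → i ≢ x → rowSum B i ≡ rowSum A i
rowSum-other ins {i} i≢x = sum-cong-≗ (λ j → cong ⟦_⟧ (ins .others i j (inj₁ i≢x)))

total-suc : Inserts A x y B → total B ≡ suc (total A)
total-suc {x = x} ins = sum-increase x (rowSum-suc ins) (λ _ → rowSum-other ins)

rowSum-mono : Inserts A x y B → ∀ i → rowSum A i ≤ rowSum B i
rowSum-mono {x = x} ins i with i ≟ x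
... | yes refl = ≤-trans (n≤1+n _) (≤-reflexive (sym (rowSum-suc ins)))
... | no i≢x   = ≤-reflexive (sym (rowSum-other ins i≢x))

rowSum-bounded : Inserts A x y B → rowSum A x < d → (∀ i → rowSum A i ≤ d) → ∀ i → rowSum B i ≤ d
rowSum-bounded {x = x} ins x<d ≤d i with i ≟ x
... | yes refl = ≤-trans (≤-reflexive (rowSum-suc ins)) x<d
... | no i≢x   = ≤-trans (≤-reflexive (rowSum-other ins i≢x)) (≤d i)

edge-added : Inserts A x y B → Edge B ⇒ (Edge A ∪ Link (inj₁ x) (inj₂ y))
edge-added {A = A} {x = x} {y} {B = B} ins = λ where
    (lr e) → [ (λ e → inj₁ (lr e)) , (λ { (refl , refl) → inj₂ (inj₁ (refl , refl)) }) ]′ (entry e)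
    (rl e) → [ (λ e → inj₁ (rl e)) , (λ { (refl , refl) → inj₂ (inj₂ (refl , refl)) }) ]′ (entry e)
  where
  entry : ∀ {i j} → T (B i j) → T (A i j) ⊎ (i ≡ x × j ≡ y)
  entry {i} {j} e with i ≟ x | j ≟ y
  ... | yes i≡x | yes j≡y = inj₂ (i≡x , j≡y)
  ... | yes _   | no j≢y  = inj₁ (subst T (ins .others i j (inj₂ j≢y)) e)
  ... | no i≢x  | _       = inj₁ (subst T (ins .others i j (inj₁ i≢x)) e)

-- As `x y` is absent from `A`, walks of `A` become walks of `B` that avoid this edge, and to these
-- the girth condition on `B` applies.
edge-kept : Inserts A x y B → Edge A ⇒ (Edge B ∖ inj₁ x , inj₂ y)
edge-kept {A = A} {x = x} {y} {B = B} ins = λ where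
    (lr e) → lr (entry e) , λ { (inj₁ (refl , refl)) → absent e }
    (rl e) → rl (entry e) , λ { (inj₂ (refl , refl)) → absent e }
  where
  absent : ¬ T (A x y)
  absent = subst T (ins .before)
  entry : ∀ {i j} → T (A i j) → T (B i j)
  entry {i} {j} e with i ≟ x | j ≟ y
  ... | yes refl | yes refl = contradiction e absent
  ... | yes _    | no j≢y   = subst T (sym (ins .others i j (inj₂ j≢y))) e
  ... | no i≢x   | _        = subst T (sym (ins .others i j (inj₁ i≢x))) e

set : Matrix n → Fin n → Fin n → Bool → Matrix n
set A x y b i j with i ≟ x | j ≟ y
... | yes _ | yes _ = b
... | _     | _     = A i j

set-eq : (A : Matrix n) (x y : Fin n) (b : Bool) → set A x y b x y ≡ b
set-eq A x y b with x ≟ x | y ≟ y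
... | yes _  | yes _  = refl
... | no x≢x | _      = contradiction refl x≢x
... | yes _  | no y≢y = contradiction refl y≢y

set-other : (A : Matrix n) (x y : Fin n) (b : Bool) → ∀ i j → i ≢ x ⊎ j ≢ y → set A x y b i j ≡ A i j
set-other A x y b i j off with i ≟ x | j ≟ y
... | yes refl | yes refl = [ contradiction refl , contradiction refl ]′ off
... | yes _    | no _     = refl
... | no _     | yes _    = refl
... | no _     | no _     = refl

inserts-true : A x y ≡ false → Inserts A x y (set A x y true)
inserts-true {A = A} {x} {y} eq = record
  { before = eq ; after = set-eq A x y true ; others = set-other A x y true }

inserts-false : A x y ≡ true → Inserts (set A x y false) x y A
inserts-false {A = A} {x} {y} eq = record
  { before = set-eq A x y false ; after = eq ; others = λ i j off → sym (set-other A x y false i j off) }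

-- The value 5 excludes cycles of length at most 6; the graph being bipartite, its girth is then at
-- least 8.
record Admissible (d : ℕ) (A : Matrix n) : Set where
  field
    girth : GirthAbove 5 (Edge A)
    rows  : ∀ u → rowSum A u ≤ d
    cols  : ∀ v → rowSum (flip A) v ≤ d
open Admissible

admissible-⊆ : Inserts A x y B → Admissible d B → Admissible d A
admissible-⊆ ins adm .girth  = girth-⊆ (λ e → proj₁ (edge-kept ins e)) (adm .girth)
admissible-⊆ ins adm .rows u = ≤-trans (rowSum-mono ins u) (adm .rows u)
admissible-⊆ ins adm .cols v = ≤-trans (rowSum-mono (inserts-flip ins) v) (adm .cols v)

admissible-⊇ : Inserts A x y B → Admissible d A →
               ¬ Walk (Edge A) 5 (inj₁ x) (inj₂ y) → rowSum A x < d → rowSum (flip A) y < d →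
               Admissible d B
admissible-⊇ ins adm far x<d y<d .girth =
  girth-⊆ (edge-added ins) (girth-add Edge-sym (adm .girth) far)
admissible-⊇ ins adm far x<d y<d .rows = rowSum-bounded ins x<d (adm .rows)
admissible-⊇ ins adm far x<d y<d .cols = rowSum-bounded (inserts-flip ins) y<d (adm .cols)

non-edge : ∀ {i} {A : Matrix n} → ¬ Walk (Edge A) (suc i) (inj₁ x) (inj₂ y) → A x y ≡ false
non-edge {x = x} {y} {A = A} far with A x y in eq
... | false = refl
... | true  = contradiction (step (lr (subst T (sym eq) tt)) here) far

-- Balls and remote vertices.

neighbours : Matrix n → Vertex n → List (Vertex n)
neighbours A (inj₁ u) = map inj₂ (trues (A u))
neighbours A (inj₂ v) = map inj₁ (trues (flip A v))

∈-neighbours : (A : Matrix n) → ∀ {s t} → Edge A s t → t ∈ neighbours A s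
∈-neighbours A (lr {u} e)     = ∈-map⁺ inj₂ (∈-trues (A u) e)
∈-neighbours A (rl {v = v} e) = ∈-map⁺ inj₁ (∈-trues (flip A v) e)

length-neighbours : Admissible d A → ∀ s → length (neighbours A s) ≤ d
length-neighbours {A = A} adm (inj₁ u) =
  ≤-trans (≤-reflexive (trans (length-map inj₂ (trues (A u))) (length-trues (A u)))) (adm .rows u)
length-neighbours {A = A} adm (inj₂ v) =
  ≤-trans (≤-reflexive (trans (length-map inj₁ (trues (flip A v))) (length-trues (flip A v)))) (adm .cols v)

-- Vertices may be listed repeatedly, since only an upper bound on the length is wanted.
ball : Matrix n → ℕ → Vertex n → List (Vertex n)
ball A zero    s = s ∷ []
ball A (suc k) s = s ∷ concatMap (ball A k) (neighbours A s)

ballSize : ℕ → ℕ → ℕ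
ballSize d zero    = 1
ballSize d (suc k) = suc (d * ballSize d k)

∈-ball : ∀ {k s t} → Walk (Edge A) k s t → t ∈ ball A k s
∈-ball {k = zero}  here = here refl
∈-ball {k = suc k} here = here refl
∈-ball {A = A} {k = suc k} (step e p) =
  there (∈-concatMap⁺ (ball A k) (Any.map (λ { refl → ∈-ball p }) (∈-neighbours A e)))

length-concatMap-≤ : ∀ {X Y : Set} {b} (f : X → List Y) → (∀ x → length (f x) ≤ b) →
                     ∀ xs → length (concatMap f xs) ≤ length xs * b
length-concatMap-≤ f f≤b []       = z≤n
length-concatMap-≤ f f≤b (x ∷ xs) =
  ≤-trans (≤-reflexive (length-++ (f x))) (+-mono-≤ (f≤b x) (length-concatMap-≤ f f≤b xs))

length-ball : Admissible d A → ∀ k s → length (ball A k s) ≤ ballSize d k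
length-ball adm zero    s = ≤-refl
length-ball {d = d} {A = A} adm (suc k) s =
  s≤s (≤-trans (length-concatMap-≤ (ball A k) (length-ball adm k) (neighbours A s))
               (*-monoˡ-≤ (ballSize d k) (length-neighbours adm s)))

_∈?_ : (s : Vertex n) (xs : List (Vertex n)) → Dec (s ∈ xs)
_∈?_ = DecMembership._∈?_ (Sum.≡-dec _≟_ _≟_)

-- Otherwise sending each left vertex to its position in `xs` would inject `Fin n` into fewer than
-- `n` positions.
avoid : (xs : List (Vertex n)) → length xs < n → ∃[ u ] ¬ inj₁ u ∈ xs
avoid {n} xs short with any? (λ u → ¬? (inj₁ u ∈? xs))
... | yes found = found
... | no none   = contradiction (injective⇒≤ index-injective) (<⇒≱ short)
  where
  covered : ∀ u → inj₁ u ∈ xs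
  covered u with inj₁ u ∈? xs
  ... | yes u∈ = u∈
  ... | no  u∉ = contradiction (u , u∉) none
  index-injective : ∀ {u v} → Any.index (covered u) ≡ Any.index (covered v) → u ≡ v
  index-injective {u} {v} eq =
    Sum.inj₁-injective (trans (Any.lookup-index (covered u))
      (trans (cong (Data.List.lookup xs) eq) (sym (Any.lookup-index (covered v)))))

-- The balls around `s` and `t` together have fewer than `n` entries, so some left vertex lies
-- outside both; a walk from it to `s` or `t`, reversed, would put it inside.
remote : Admissible d A → ∀ k s t → ballSize d k + ballSize d k < n →
         ∃[ u ] ¬ Walk (Edge {n} A) k (inj₁ u) s × ¬ Walk (Edge A) k (inj₁ u) t
remote {A = A} adm k s t large =
  let u , u∉ = avoid (ball A k s ++ ball A k t)
                 (≤-<-trans (≤-trans (≤-reflexive (length-++ (ball A k s)))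
                                     (+-mono-≤ (length-ball adm k s) (length-ball adm k t))) large)
  in u , (λ p → u∉ (∈-++⁺ˡ (∈-ball (reverse-walk Edge-sym p))))
       , (λ p → u∉ (∈-++⁺ʳ (ball A k s) (∈-ball (reverse-walk Edge-sym p))))

-- Existence of regular graphs of large girth.

sum-positive : (f : Fin n → Bool) → 0 < sum (⟦_⟧ ∘ f) → ∃[ i ] f i ≡ true
sum-positive {suc n} f pos with f zero in eq
... | true  = zero , eq
... | false = let i , fi = sum-positive (f ∘ suc) pos in suc i , fi

-- Erdős–Sachs: take a left vertex u remote from the deficient vertices x and y.
-- Either u y can be added, or u has a neighbour v and the edge u v is traded for
-- the two edges x v and u y.
enlarge : {A : Matrix n} → ballSize d 6 + ballSize d 6 < n → Admissible d A → total A < n * d →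
          Σ[ B ∈ Matrix n ] Admissible d B × total B ≡ suc (total A)
enlarge {n} {d} {A} large adm few
  with x , x<d ← sum-deficient (rowSum A) few
  with y , y<d ← sum-deficient (rowSum (flip A)) (≤-trans (s≤s (≤-reflexive (total-flip A))) few)
  -- Radius 6, one more than the girth condition asks for, leaves room for an extra step along the
  -- edge `u v` in `x↛v`.
  with u , u↛x , u↛y ← remote adm 6 (inj₁ x) (inj₂ y) large
  with rowSum A u <? d
... | yes u<d = _ , admissible-⊇ ins adm far u<d y<d , total-suc ins
  where
  far : ¬ Walk (Edge A) 5 (inj₁ u) (inj₂ y)
  far p = u↛y (weaken (n≤1+n _) p)
  ins = inserts-true (non-edge far)
... | no u≮d
  -- `u` has degree at least `d`, and `d` is positive because `x` has degree below it.
  with v , uv ← sum-positive (A u) (≤-trans (s≤s z≤n) (≤-trans x<d (≮⇒≥ u≮d)))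
  = _ , admissible-⊇ ins₂ adm₁ u↛₁y u<d y<₁d , tot
  where
  A⁻ = set A u v false
  A₁ = set A⁻ x v true
  u–v : Edge A (inj₁ u) (inj₂ v)
  u–v = lr (subst T (sym uv) tt)
  ins⁻ : Inserts A⁻ u v A
  ins⁻ = inserts-false uv
  adm⁻ : Admissible d A⁻
  adm⁻ = admissible-⊆ ins⁻ adm
  old : ∀ {k s t} → Walk (Edge A⁻) k s t → Walk (Edge A) k s t
  old = map-walk (λ e → proj₁ (edge-kept ins⁻ e))
  x↛v : ¬ Walk (Edge A⁻) 5 (inj₁ x) (inj₂ v)
  x↛v p = u↛x (step u–v (reverse-walk Edge-sym (old p)))
  u≢x : u ≢ x
  u≢x refl = u↛x here
  y≢v : y ≢ v
  y≢v refl = u↛y (step u–v here)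
  ins₁ : Inserts A⁻ x v A₁
  ins₁ = inserts-true (non-edge x↛v)
  adm₁ : Admissible d A₁
  adm₁ = admissible-⊇ ins₁ adm⁻ x↛v
    (≤-<-trans (rowSum-mono ins⁻ x) x<d)
    -- Deleting `u v` has freed a place at `v`, even if its degree was `d`.
    (≤-trans (≤-reflexive (sym (rowSum-suc (inserts-flip ins⁻)))) (adm .cols v))
  u↛₁y : ¬ Walk (Edge A₁) 5 (inj₁ u) (inj₂ y)
  -- Without `x v` this is a walk of `A`. Crossing from `x` to `v`, it first leads from `u` to `x`,
  -- which are far apart. Crossing from `v` to `x`, it first leads from `u` to `v` without the
  -- deleted edge, which would close a short cycle of `A`.
  u↛₁y p with splice (map-walk (edge-added ins₁) p)
  ... | inj₁ q = u↛y (weaken (n≤1+n _) (old q))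
  ... | inj₂ (inj₁ (i , j , ij , q , _)) =
    u↛x (weaken (m≤n⇒m≤1+n (m+n≤o⇒m≤o i ij)) (old q))
  ... | inj₂ (inj₂ (i , j , ij , q , _)) =
    adm .girth u–v (weaken (m+n≤o⇒m≤o i ij) (map-walk (edge-kept ins⁻) q))
  ins₂ = inserts-true (non-edge u↛₁y)
  u<d : rowSum A₁ u < d
  u<d = ≤-trans (≤-reflexive (trans (cong suc (rowSum-other ins₁ u≢x)) (sym (rowSum-suc ins⁻))))
                (adm .rows u)
  y<₁d : rowSum (flip A₁) y < d
  y<₁d = ≤-<-trans (≤-reflexive (rowSum-other (inserts-flip ins₁) y≢v))
                   (≤-<-trans (rowSum-mono (inserts-flip ins⁻) y) y<d)
  tot : total (set A₁ u y true) ≡ suc (total A)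
  tot = trans (total-suc ins₂) (cong suc (trans (total-suc ins₁) (sym (total-suc ins⁻))))

empty : Matrix n
empty _ _ = false

empty-admissible : Admissible {n} d empty
empty-admissible .girth (lr ())
empty-admissible .girth (rl ())
empty-admissible {n} .rows _ = ≤-trans (≤-reflexive (sum-replicate-zero n)) z≤n
empty-admissible {n} .cols _ = ≤-trans (≤-reflexive (sum-replicate-zero n)) z≤n

with-edges : ballSize d 6 + ballSize d 6 < n → ∀ e → e ≤ n * d →
             Σ[ A ∈ Matrix n ] Admissible d A × total A ≡ e
with-edges {n = n} large zero    _ = empty , empty-admissible , trans (sum-cong-≗ {n} (λ _ → sum-replicate-zero n)) (sum-replicate-zero n)
with-edges large (suc e) e<nd with with-edges large e (<⇒≤ e<nd)
... | A , adm , refl = enlarge large adm e<nd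

regular-of-large-girth : ballSize d 6 + ballSize d 6 < n →
  Σ[ A ∈ Matrix n ] GirthAbove 5 (Edge A) × (∀ u → rowSum A u ≡ d) × (∀ v → rowSum (flip A) v ≡ d)
regular-of-large-girth large with with-edges large _ ≤-refl
... | A , adm , tot = A , adm .girth ,
  sum-saturated _ (adm .rows) (≤-reflexive (sym tot)) ,
  sum-saturated _ (adm .cols) (≤-reflexive (sym (trans (total-flip A) tot)))

-- Sums over lists and over their sublists.

private variable
  X : Set

sum-map-0 : (xs : List X) → List.sum (map (λ _ → 0) xs) ≡ 0
sum-map-0 []       = refl
sum-map-0 (_ ∷ xs) = sum-map-0 xs

sum-map-+ : (f g : X → ℕ) (xs : List X) →
            List.sum (map (λ x → f x + g x) xs) ≡ List.sum (map f xs) + List.sum (map g xs)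
sum-map-+ f g []       = refl
sum-map-+ f g (x ∷ xs) =
  trans (cong (f x + g x +_) (sum-map-+ f g xs)) (interchange (f x) (g x) _ _)

sum-map-*ʳ : (c : ℕ) (f : X → ℕ) (xs : List X) →
             List.sum (map (λ x → f x * c) xs) ≡ List.sum (map f xs) * c
sum-map-*ʳ c f []       = refl
sum-map-*ʳ c f (x ∷ xs) = trans (cong (f x * c +_) (sum-map-*ʳ c f xs)) (sym (*-distribʳ-+ c (f x) _))

-- Summation over all sublists of a list. Expectations over a random independent set become such
-- sums of indicators, without division.
∑ : List X → (List X → ℕ) → ℕ
∑ []       F = F []
∑ (x ∷ xs) F = ∑ xs F + ∑ xs (F ∘ (x ∷_))

∑-mono : {P : X → Set} {F G : List X → ℕ} → (∀ {W} → All P W → F W ≤ G W) →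
         ∀ {xs} → All P xs → ∑ xs F ≤ ∑ xs G
∑-mono F≤G []       = F≤G []
∑-mono F≤G (p ∷ ps) = +-mono-≤ (∑-mono F≤G ps) (∑-mono (λ qs → F≤G (p ∷ qs)) ps)

∑-cong-All : {P : X → Set} {F G : List X → ℕ} → (∀ {W} → All P W → F W ≡ G W) →
             ∀ {xs} → All P xs → ∑ xs F ≡ ∑ xs G
∑-cong-All F≡G ps =
  ≤-antisym (∑-mono (λ q → ≤-reflexive (F≡G q)) ps) (∑-mono (λ q → ≤-reflexive (sym (F≡G q))) ps)

∑-cong : {F G : List X → ℕ} → (∀ W → F W ≡ G W) → ∀ xs → ∑ xs F ≡ ∑ xs G
∑-cong F≡G []       = F≡G []
∑-cong F≡G (x ∷ xs) = cong₂ _+_ (∑-cong F≡G xs) (∑-cong (F≡G ∘ (x ∷_)) xs)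

∑-+ : (F G : List X → ℕ) → ∀ xs → ∑ xs (λ W → F W + G W) ≡ ∑ xs F + ∑ xs G
∑-+ F G []       = refl
∑-+ F G (x ∷ xs) =
  trans (cong₂ _+_ (∑-+ F G xs) (∑-+ (F ∘ (x ∷_)) (G ∘ (x ∷_)) xs)) (interchange (∑ xs F) _ _ _)

∑-*ˡ : (c : ℕ) (F : List X → ℕ) → ∀ xs → ∑ xs (λ W → c * F W) ≡ c * ∑ xs F
∑-*ˡ c F []       = refl
∑-*ˡ c F (x ∷ xs) =
  trans (cong₂ _+_ (∑-*ˡ c F xs) (∑-*ˡ c (F ∘ (x ∷_)) xs)) (sym (*-distribˡ-+ c (∑ xs F) _))

∑-zero : (xs : List X) → ∑ xs (λ _ → 0) ≡ 0
∑-zero []       = refl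
∑-zero (x ∷ xs) = cong₂ _+_ (∑-zero xs) (∑-zero xs)

∑-≥[] : (F : List X → ℕ) → ∀ xs → F [] ≤ ∑ xs F
∑-≥[] F []       = ≤-refl
∑-≥[] F (x ∷ xs) = ≤-trans (∑-≥[] F xs) (m≤m+n _ _)

-- Conditioning: the outer sum fixes the choice `S` made in `ys`, the inner one runs over its
-- completions in `xs`.
∑-++ : (F : List X → ℕ) → ∀ xs ys → ∑ (xs ++ ys) F ≡ ∑ ys (λ S → ∑ xs (λ T → F (T ++ S)))
∑-++ F []       ys = refl
∑-++ F (x ∷ xs) ys =
  trans (cong₂ _+_ (∑-++ F xs ys) (∑-++ (F ∘ (x ∷_)) xs ys)) (sym (∑-+ _ _ ys))

-- This lets a vertex and its neighbours be moved to the front of the list before conditioning on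
-- the rest.
∑-↭ : {F : List X → ℕ} → (∀ {V W} → V ↭ W → F V ≡ F W) → ∀ {xs ys} → xs ↭ ys → ∑ xs F ≡ ∑ ys F
∑-↭ resp _↭_.refl = refl
∑-↭ resp (prep x p) = cong₂ _+_ (∑-↭ resp p) (∑-↭ (resp ∘ prep x) p)
∑-↭ {F = F} resp (swap {xs = xs} {ys = ys} x y p) =
  trans (cong₂ _+_ (cong₂ _+_ (∑-↭ resp p) (∑-↭ (resp ∘ prep y) p))
                   (cong₂ _+_ (∑-↭ (resp ∘ prep x) p)
                              (trans (∑-↭ (resp ∘ prep x ∘ prep y) p)
                                     (∑-cong (λ W → resp (swap x y _↭_.refl)) ys))))
        (interchange (∑ ys F) _ _ _)
∑-↭ resp (_↭_.trans p q) = trans (∑-↭ resp p) (∑-↭ resp q)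

-- The first moment argument, in counting form. The strict inequality must survive in the sublists
-- without `x` or in those with `x`.
∑-pigeonhole : (p : List X → Bool) (g : List X → ℕ) (c : ℕ) → ∀ xs →
               c * ∑ xs (⟦_⟧ ∘ p) < ∑ xs (λ W → ⟦ p W ⟧ * g W) →
               ∃[ W ] W ⊑ xs × p W ≡ true × c < g W
∑-pigeonhole p g c [] lt with p [] in eq
... | true  = [] , [] , eq , subst₂ _<_ (*-identityʳ c) (+-identityʳ (g [])) lt
... | false = contradiction (subst (_< 0) (*-zeroʳ c) lt) λ ()
∑-pigeonhole p g c (x ∷ xs) lt
  with c * ∑ xs (⟦_⟧ ∘ p) <? ∑ xs (λ W → ⟦ p W ⟧ * g W)
... | yes lt₀ = let W , W⊑ , pW , c<g = ∑-pigeonhole p g c xs lt₀ in W , x ∷ʳ W⊑ , pW , c<g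
... | no  ge₀ =
  let W , W⊑ , pW , c<g = ∑-pigeonhole (p ∘ (x ∷_)) (g ∘ (x ∷_)) c xs
        (+-cancelˡ-< _ _ _ (≤-<-trans (+-monoˡ-≤ _ (≮⇒≥ ge₀)) (≤-<-trans (≤-reflexive (sym (*-distribˡ-+ c (∑ xs (⟦_⟧ ∘ p)) _))) lt)))
  in x ∷ W , refl ∷ W⊑ , pW , c<g

-- The sum of the sizes of all subsets of a set with x elements, x 2^x / 2.
sizes : ℕ → ℕ
sizes zero    = 0
sizes (suc x) = sizes x + (2 ^ x + sizes x)

2*sizes : ∀ x → 2 * sizes x ≡ x * 2 ^ x
2*sizes zero    = refl
2*sizes (suc x) = trans (regroup (sizes x) (2 ^ x)) (trans (cong (λ z → 2 * z + 2 * 2 ^ x) (2*sizes x)) (factor x (2 ^ x)))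
  where
  regroup : ∀ a b → 2 * (a + (b + a)) ≡ 2 * (2 * a) + 2 * b
  regroup = solve-∀
  factor : ∀ x b → 2 * (x * b) + 2 * b ≡ (1 + x) * (2 * b)
  factor = solve-∀

n<2^n : ∀ n → n < 2 ^ n
n<2^n zero    = s≤s z≤n
n<2^n (suc n) = +-mono-≤ (m^n>0 2 n) (≤-trans (n<2^n n) (m≤m+n (2 ^ n) 0))

-- For `x` at most `2 * L` the term `D` alone suffices. For larger `x`, twice `sizes x` is
-- `x * 2 ^ x`, at least `2 * L + 1` times `2 ^ x`, and the surplus `2 ^ x` exceeds `2 * L`.
local-bound : ∀ {D} L x → L * 2 ^ (2 * L) + L ≤ D → L * (2 ^ x + 1) ≤ sizes x + D
local-bound {D} L x L≤D with x ≤? 2 * L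
... | yes x≤2L = begin
  L * (2 ^ x + 1)         ≡⟨ *-distribˡ-+ L (2 ^ x) 1 ⟩
  L * 2 ^ x + L * 1       ≡⟨ cong (L * 2 ^ x +_) (*-identityʳ L) ⟩
  L * 2 ^ x + L           ≤⟨ +-monoˡ-≤ L (*-monoʳ-≤ L (^-monoʳ-≤ 2 x≤2L)) ⟩
  L * 2 ^ (2 * L) + L     ≤⟨ L≤D ⟩
  D                       ≤⟨ m≤n+m D (sizes x) ⟩
  sizes x + D             ∎
  where open ≤-Reasoning
... | no x≰2L = ≤-trans (*-cancelˡ-≤ 2 (begin
  2 * (L * (2 ^ x + 1))     ≡⟨ expand L (2 ^ x) ⟩
  2 * L * 2 ^ x + 2 * L     ≤⟨ +-monoʳ-≤ (2 * L * 2 ^ x) (≤-trans (<⇒≤ (≰⇒> x≰2L)) (<⇒≤ (n<2^n x))) ⟩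
  2 * L * 2 ^ x + 2 ^ x     ≡⟨ +-comm (2 * L * 2 ^ x) (2 ^ x) ⟩
  suc (2 * L) * 2 ^ x       ≤⟨ *-monoˡ-≤ (2 ^ x) (≰⇒> x≰2L) ⟩
  x * 2 ^ x                 ≡⟨ sym (2*sizes x) ⟩
  2 * sizes x               ∎)) (m≤m+n (sizes x) D)
  where
  open ≤-Reasoning
  expand : ∀ l p → 2 * (l * (p + 1)) ≡ 2 * l * p + 2 * l
  expand = solve-∀

⟦∧⟧ : ∀ a b → ⟦ a ∧ b ⟧ ≡ ⟦ b ⟧ * ⟦ a ⟧
⟦∧⟧ true  true  = refl
⟦∧⟧ true  false = refl
⟦∧⟧ false true  = refl
⟦∧⟧ false false = refl

-- Large independent sets in triangle-free graphs.

module Independent {X : Set} (adj : X → X → Bool) (adj-sym : ∀ x y → adj x y ≡ adj y x) where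

  free : X → List X → Bool
  free w []      = true
  free w (s ∷ S) = not (adj w s) ∧ free w S

  indep : List X → Bool
  indep []      = true
  indep (w ∷ W) = free w W ∧ indep W

  ∧-interchange : ∀ a b c d → (a ∧ b) ∧ (c ∧ d) ≡ (a ∧ c) ∧ (b ∧ d)
  ∧-interchange false b     c     d = refl
  ∧-interchange true  true  c     d = refl
  ∧-interchange true  false true  d = refl
  ∧-interchange true  false false d = refl

  ∧-swap : ∀ a b c → a ∧ (b ∧ c) ≡ b ∧ (a ∧ c)
  ∧-swap = ∧-interchange true

  free-↭ : ∀ w {S T} → S ↭ T → free w S ≡ free w T
  free-↭ w _↭_.refl        = refl
  free-↭ w (prep x p)      = cong (not (adj w x) ∧_) (free-↭ w p)
  free-↭ w (swap x y p)    =
    trans (cong (λ b → not (adj w x) ∧ (not (adj w y) ∧ b)) (free-↭ w p)) (∧-swap (not (adj w x)) (not (adj w y)) _)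
  free-↭ w (_↭_.trans p q) = trans (free-↭ w p) (free-↭ w q)

  indep-↭ : ∀ {V W} → V ↭ W → indep V ≡ indep W
  indep-↭ _↭_.refl        = refl
  indep-↭ (prep x p)      = cong₂ _∧_ (free-↭ x p) (indep-↭ p)
  indep-↭ (swap x y p)    =
    trans (cong₂ _∧_ (cong₂ _∧_ (cong not (adj-sym x y)) (free-↭ x p)) (cong₂ _∧_ (free-↭ y p) (indep-↭ p)))
          (∧-interchange (not (adj y x)) _ _ _)
  indep-↭ (_↭_.trans p q) = trans (indep-↭ p) (indep-↭ q)

  free-++ : ∀ w S T → free w (S ++ T) ≡ free w S ∧ free w T
  free-++ w []      T = refl
  free-++ w (s ∷ S) T = trans (cong (not (adj w s) ∧_) (free-++ w S T)) (sym (∧-assoc (not (adj w s)) _ _))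

  free-All : ∀ {w S} → All (λ s → adj w s ≡ false) S → free w S ≡ true
  free-All []       = refl
  free-All (p ∷ ps) rewrite p = free-All ps

  allFree : List X → List X → Bool
  allFree S []      = true
  allFree S (w ∷ T) = free w S ∧ allFree S T

  -- For the neighbours `N` of a vertex this is the `x` of `local-bound`.
  freeCount : List X → List X → ℕ
  freeCount S []      = 0
  freeCount S (w ∷ N) = ⟦ free w S ⟧ + freeCount S N

  -- Each free element of `N` may be taken or left, every other one must be left.
  ∑-allFree : ∀ S N → ∑ N (λ T → ⟦ allFree S T ⟧) ≡ 2 ^ freeCount S N
  ∑-allFree S []      = refl
  ∑-allFree S (w ∷ N) with free w S
  ... | true  = trans (cong₂ _+_ (∑-allFree S N) (∑-allFree S N)) (cong (2 ^ freeCount S N +_) (sym (+-identityʳ _)))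
  ... | false = trans (cong₂ _+_ (∑-allFree S N) (∑-zero N)) (+-identityʳ _)

  ∑-allFree-length : ∀ S N → ∑ N (λ T → ⟦ allFree S T ⟧ * length T) ≡ sizes (freeCount S N)
  ∑-allFree-length S []      = refl
  ∑-allFree-length S (w ∷ N) with free w S
  ... | true  = cong₂ _+_ (∑-allFree-length S N)
    (trans (∑-cong (λ T → *-suc ⟦ allFree S T ⟧ (length T)) N)
    (trans (∑-+ _ _ N) (cong₂ _+_ (∑-allFree S N) (∑-allFree-length S N))))
  ... | false = trans (cong₂ _+_ (∑-allFree-length S N) (∑-zero N)) (+-identityʳ _)

  ∑-null : (N : List X) → ∑ N (λ T → ⟦ null T ⟧) ≡ 1
  ∑-null []      = refl
  ∑-null (w ∷ N) = cong₂ _+_ (∑-null N) (∑-zero N)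

  splitAdj : ∀ v xs → ∃₂ λ N H → xs ↭ N ++ H × All (λ w → adj v w ≡ true) N × All (λ w → adj v w ≡ false) H
  splitAdj v []       = [] , [] , _↭_.refl , [] , []
  splitAdj v (x ∷ xs) with adj v x in eq | splitAdj v xs
  ... | true  | N , H , p , N-adj , H-non = x ∷ N , H , prep x p , eq ∷ N-adj , H-non
  ... | false | N , H , p , N-adj , H-non =
    N , x ∷ H , ↭-trans (prep x p) (↭-sym (shift x N H)) , N-adj , eq ∷ H-non

  module _ (eq : X → X → Bool) (eq-refl : ∀ v → eq v v ≡ true)
           (D L : ℕ) (L≤D : L * 2 ^ (2 * L) + L ≤ D) (xs : List X)
           (triangle-free : ∀ {v a b} → v ∈ xs → a ∈ xs → b ∈ xs →
                            adj v a ≡ true → adj v b ≡ true → adj a b ≡ false)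
           (degree : ∀ w → List.sum (map (λ v → ⟦ adj v w ⟧) xs) ≤ D)
           (distinct : ∀ w → List.sum (map (λ v → ⟦ eq v w ⟧) xs) ≤ 1) where

    -- Writing the weight as a sum over the elements of `W` allows the sums over `v` and over `W` to
    -- be exchanged later.
    kernel : X → X → ℕ
    kernel v w = ⟦ eq v w ⟧ * D + ⟦ adj v w ⟧

    weight : X → List X → ℕ
    weight v W = List.sum (map (kernel v) W)

    weight-↭ : ∀ v {V W} → V ↭ W → weight v V ≡ weight v W
    weight-↭ v p = sum-↭ (↭.map⁺ (kernel v) p)

    length≤weight : ∀ {v T} S → All (λ w → adj v w ≡ true) T → length T ≤ weight v (T ++ S)
    length≤weight S []                = z≤n
    length≤weight {v} {w ∷ T} S (p ∷ ps) =
      +-mono-≤ (≤-trans (≤-reflexive (cong ⟦_⟧ (sym p))) (m≤n+m ⟦ adj v w ⟧ _)) (length≤weight S ps)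

    D≤weight : ∀ v W → D ≤ weight v (v ∷ W)
    D≤weight v W rewrite eq-refl v = ≤-trans (m≤m+n D 0) (≤-trans (m≤m+n (D + 0) _) (m≤m+n _ (weight v W)))

    weighted : X → List X → ℕ
    weighted v W = ⟦ indep W ⟧ * weight v W

    Nbr : X → X → Set
    Nbr v w = w ∈ xs × adj v w ≡ true

    module _ {v : X} (v∈xs : v ∈ xs) where

      free-Nbr : ∀ {w T} → Nbr v w → All (Nbr v) T → free w T ≡ true
      free-Nbr (w∈ , vw) ps = free-All (All.map (λ (t∈ , vt) → triangle-free v∈xs w∈ t∈ vw vt) ps)

      -- Two neighbours of `v` are never adjacent, by triangle-freeness, so `T` has no conflicts
      -- inside.
      indep-++ : ∀ S {T} → All (Nbr v) T → indep (T ++ S) ≡ allFree S T ∧ indep S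
      indep-++ S []                = refl
      indep-++ S {w ∷ T} (p ∷ ps) =
        trans (cong₂ _∧_ (trans (free-++ w T S) (cong (_∧ free w S) (free-Nbr p ps))) (indep-++ S ps))
              (sym (∧-assoc (free w S) _ _))

      -- Taking `v` forbids all its neighbours and does not interfere with `S`.
      indep-∷-++ : ∀ {S T} → All (λ s → adj v s ≡ false) S → All (Nbr v) T →
                   indep (v ∷ T ++ S) ≡ null T ∧ indep S
      indep-∷-++ non []             rewrite free-All non = refl
      indep-∷-++ non ((_ , vt) ∷ _) rewrite vt = refl

      -- If `S` is independent, its independent completions are the `2 ^ k` sets of free neighbours,
      -- of weight at least their sizes, and `v` alone, of weight at least `D`; `local-bound`
      -- compares the two totals. The factor `s` makes both totals for other `S` vanish.
      local-∑ : ∀ {S N} → All (λ s → adj v s ≡ false) S → All (Nbr v) N →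
                L * ∑ (v ∷ N) (λ T → ⟦ indep (T ++ S) ⟧) ≤ ∑ (v ∷ N) (λ T → weighted v (T ++ S))
      local-∑ {S} {N} non nbrs = begin
        L * (∑ N (λ T → ⟦ indep (T ++ S) ⟧) + ∑ N (λ T → ⟦ indep (v ∷ T ++ S) ⟧))
          ≡⟨ cong (L *_) (cong₂ _+_ without with-v) ⟩
        L * (s * 2 ^ k + s * 1)
          ≡⟨ regroup L s (2 ^ k) ⟩
        s * (L * (2 ^ k + 1))
          ≤⟨ *-monoʳ-≤ s (local-bound L k L≤D) ⟩
        s * (sizes k + D)
          ≡⟨ *-distribˡ-+ s (sizes k) D ⟩
        s * sizes k + s * D
          ≤⟨ +-mono-≤ without-weighted with-v-weighted ⟩
        ∑ N (λ T → weighted v (T ++ S)) + ∑ N (λ T → weighted v (v ∷ T ++ S)) ∎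
        where
        open ≤-Reasoning
        s = ⟦ indep S ⟧
        k = freeCount S N
        regroup : ∀ l s p → l * (s * p + s * 1) ≡ s * (l * (p + 1))
        regroup = solve-∀
        count-++ : ∀ {T} → All (Nbr v) T → ⟦ indep (T ++ S) ⟧ ≡ s * ⟦ allFree S T ⟧
        count-++ {T} ps = trans (cong ⟦_⟧ (indep-++ S ps)) (⟦∧⟧ (allFree S T) (indep S))
        count-∷-++ : ∀ {T} → All (Nbr v) T → ⟦ indep (v ∷ T ++ S) ⟧ ≡ s * ⟦ null T ⟧
        count-∷-++ {T} ps = trans (cong ⟦_⟧ (indep-∷-++ non ps)) (⟦∧⟧ (null T) (indep S))
        without : ∑ N (λ T → ⟦ indep (T ++ S) ⟧) ≡ s * 2 ^ k
        without = trans (∑-cong-All count-++ nbrs) (trans (∑-*ˡ s _ N) (cong (s *_) (∑-allFree S N)))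
        with-v : ∑ N (λ T → ⟦ indep (v ∷ T ++ S) ⟧) ≡ s * 1
        with-v = trans (∑-cong-All count-∷-++ nbrs) (trans (∑-*ˡ s _ N) (cong (s *_) (∑-null N)))
        without-weighted : s * sizes k ≤ ∑ N (λ T → weighted v (T ++ S))
        without-weighted = ≤-trans
          (≤-reflexive (sym (trans (∑-*ˡ s _ N) (cong (s *_) (∑-allFree-length S N)))))
          (∑-mono (λ {T} ps → ≤-trans
            (≤-reflexive (trans (sym (*-assoc s ⟦ allFree S T ⟧ (length T))) (cong (_* length T) (sym (count-++ ps)))))
            (*-monoʳ-≤ ⟦ indep (T ++ S) ⟧ (length≤weight S (All.map (λ (_ , a) → a) ps)))) nbrs)
        with-v-weighted : s * D ≤ ∑ N (λ T → weighted v (v ∷ T ++ S))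
        with-v-weighted = ≤-trans
          (≤-reflexive (sym (trans (∑-*ˡ (s * D) _ N) (trans (cong (s * D *_) (∑-null N)) (*-identityʳ _)))))
          (∑-mono (λ {T} ps → ≤-trans
            (≤-reflexive (trans (swap-factors s D ⟦ null T ⟧) (cong (_* D) (sym (count-∷-++ ps)))))
            (*-monoʳ-≤ ⟦ indep (v ∷ T ++ S) ⟧ (D≤weight v (T ++ S)))) nbrs)
          where
          swap-factors : ∀ a b c → a * b * c ≡ a * c * b
          swap-factors = solve-∀

      -- The list is rearranged into `v`, its neighbours `N` and the remaining `H`; then `local-∑`
      -- is summed over all choices in `H`.
      vertex-bound : L * ∑ xs (⟦_⟧ ∘ indep) ≤ ∑ xs (weighted v)
      vertex-bound
        with ys , zs , refl ← ∈-∃++ v∈xs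
        with N , H , p , N-adj , H-non ← splitAdj v (ys ++ zs)
        = begin
        L * ∑ xs (⟦_⟧ ∘ indep)
          ≡⟨ cong (L *_) (trans (∑-↭ (cong ⟦_⟧ ∘ indep-↭) q) (∑-++ _ (v ∷ N) H)) ⟩
        L * ∑ H (λ S → ∑ (v ∷ N) (λ T → ⟦ indep (T ++ S) ⟧))
          ≡⟨ sym (∑-*ˡ L _ H) ⟩
        ∑ H (λ S → L * ∑ (v ∷ N) (λ T → ⟦ indep (T ++ S) ⟧))
          ≤⟨ ∑-mono (λ non → local-∑ non nbrs) H-non ⟩
        ∑ H (λ S → ∑ (v ∷ N) (λ T → weighted v (T ++ S)))
          ≡⟨ sym (trans (∑-↭ (λ r → cong₂ (λ b w → ⟦ b ⟧ * w) (indep-↭ r) (weight-↭ v r)) q) (∑-++ _ (v ∷ N) H)) ⟩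
        ∑ xs (weighted v) ∎
        where
        open ≤-Reasoning
        q : xs ↭ (v ∷ N) ++ H
        q = ↭-trans (shift v ys zs) (prep v p)
        nbrs : All (Nbr v) N
        nbrs = All.tabulate λ w∈N →
          ↭.∈-resp-↭ (↭-sym q) (there (∈-++⁺ˡ w∈N)) , All.lookup N-adj w∈N

    -- Double counting: `w` gives `D` to itself, at most once by `distinct`, and 1 to each of its at
    -- most `D` neighbours.
    kernel-bound : ∀ w → List.sum (map (λ v → kernel v w) xs) ≤ D + D
    kernel-bound w = begin
      List.sum (map (λ v → kernel v w) xs)
        ≡⟨ sum-map-+ _ _ xs ⟩
      List.sum (map (λ v → ⟦ eq v w ⟧ * D) xs) + List.sum (map (λ v → ⟦ adj v w ⟧) xs)
        ≤⟨ +-mono-≤ (≤-trans (≤-reflexive (sum-map-*ʳ D _ xs)) (*-monoˡ-≤ D (distinct w))) (degree w) ⟩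
      1 * D + D
        ≡⟨ cong (_+ D) (*-identityˡ D) ⟩
      D + D ∎
      where open ≤-Reasoning

    weight-bound : ∀ W → List.sum (map (λ v → weight v W) xs) ≤ length W * (D + D)
    weight-bound []      = ≤-reflexive (sum-map-0 xs)
    weight-bound (w ∷ W) =
      ≤-trans (≤-reflexive (sum-map-+ (λ v → kernel v w) (λ v → weight v W) xs)) (+-mono-≤ (kernel-bound w) (weight-bound W))

    -- A separate list `vs` carries the induction, while the sublists are those of the fixed `xs`.
    summed-bound : ∀ {vs} → All (_∈ xs) vs →
      length vs * (L * ∑ xs (⟦_⟧ ∘ indep)) ≤ ∑ xs (λ W → ⟦ indep W ⟧ * List.sum (map (λ v → weight v W) vs))
    summed-bound []                  = z≤n
    summed-bound {v ∷ vs} (v∈ ∷ vs∈) = ≤-trans (+-mono-≤ (vertex-bound v∈) (summed-bound vs∈))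
      (≤-reflexive (trans (sym (∑-+ _ _ xs)) (∑-cong (λ W → sym (*-distribˡ-+ ⟦ indep W ⟧ _ _)) xs)))

    large-independent : ∃[ W ] W ⊑ xs × indep W ≡ true × length xs * L ≤ length W * (D + D)
    large-independent with length xs * L in c≡
    ... | zero  = [] , minimum xs , refl , z≤n
    -- The pigeonhole gives a strict bound, so it is used with one less than the target. The
    -- hypothesis is strict because the empty set is independent and `P` therefore positive.
    ... | suc c = ∑-pigeonhole indep (λ W → length W * (D + D)) c xs (begin-strict
      c * P                       <⟨ *-monoˡ-< P {{>-nonZero (∑-≥[] (⟦_⟧ ∘ indep) xs)}} (n<1+n c) ⟩
      suc c * P                   ≡⟨ cong (_* P) (sym c≡) ⟩
      length xs * L * P           ≡⟨ *-assoc (length xs) L P ⟩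
      length xs * (L * P)         ≤⟨ summed-bound (All.tabulate λ v∈ → v∈) ⟩
      ∑ xs (λ W → ⟦ indep W ⟧ * List.sum (map (λ v → weight v W) xs))
        ≤⟨ ∑-mono {P = λ _ → ⊤} (λ {W} _ → *-monoʳ-≤ ⟦ indep W ⟧ (weight-bound W)) (All.universal (λ _ → tt) xs) ⟩
      ∑ xs (λ W → ⟦ indep W ⟧ * (length W * (D + D))) ∎)
      where
      open ≤-Reasoning
      P = ∑ xs (⟦_⟧ ∘ indep)

-- Pairwise related lists and sums over distinct indices.

AllPairs-resp-⊑ : {X : Set} {R : X → X → Set} {xs ys : List X} → xs ⊑ ys → AllPairs R ys → AllPairs R xs
AllPairs-resp-⊑ []         []       = []
AllPairs-resp-⊑ (_ ∷ʳ p)   (_ ∷ rs) = AllPairs-resp-⊑ p rs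
AllPairs-resp-⊑ (refl ∷ p) (r ∷ rs) = All-resp-⊆ p r ∷ AllPairs-resp-⊑ p rs

AllPairs-lookup : {X : Set} {R : X → X → Set} → (∀ {x y} → R x y → R y x) → ∀ {xs x y} →
                  AllPairs R xs → x ∈ xs → y ∈ xs → x ≢ y → R x y
AllPairs-lookup R-sym (r ∷ rs) (here refl) (here refl) x≢y = contradiction refl x≢y
AllPairs-lookup R-sym (r ∷ rs) (here refl) (there y∈)  x≢y = All.lookup r y∈
AllPairs-lookup R-sym (r ∷ rs) (there x∈)  (here refl) x≢y = R-sym (All.lookup r x∈)
AllPairs-lookup R-sym (r ∷ rs) (there x∈)  (there y∈)  x≢y = AllPairs-lookup R-sym rs x∈ y∈ x≢y

sum-map-mono : {X : Set} {f g : X → ℕ} → (∀ x → f x ≤ g x) → ∀ xs → List.sum (map f xs) ≤ List.sum (map g xs)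
sum-map-mono f≤g []       = z≤n
sum-map-mono f≤g (x ∷ xs) = +-mono-≤ (f≤g x) (sum-map-mono f≤g xs)

-- The induction continues with `g`, which vanishes at `i` and agrees with `f` on the indices still
-- to come.
sum-distinct : ∀ {n} (f : Fin n → ℕ) {is} → AllPairs _≢_ is → List.sum (map f is) ≤ sum f
sum-distinct f []                         = z≤n
sum-distinct {n} f {i ∷ is} (i≢ ∷ is-distinct) = begin
  f i + List.sum (map f is) ≡⟨ cong (f i +_) (cong List.sum (map-cong-local (All.map (λ i≢j → sym (elsewhere _ (i≢j ∘ sym))) i≢))) ⟩
  f i + List.sum (map g is) ≤⟨ +-monoʳ-≤ (f i) (sum-distinct g is-distinct) ⟩
  f i + sum g               ≡⟨ sym (sum-increase i (trans (sym (+-identityʳ (f i))) (cong (f i +_) (sym (updateAt-updates i f)))) (λ j j≢i → sym (elsewhere j j≢i))) ⟩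
  sum f                     ∎
  where
  open ≤-Reasoning
  g : Fin n → ℕ
  g = updateAt f i (const 0)
  elsewhere : ∀ j → j ≢ i → g j ≡ f j
  elsewhere j j≢i = updateAt-minimal j i f j≢i

-- The conflict graph of a matching.

graph : Matrix n → BipartiteGraph n
graph A = record { adj = A }

module _ {n d : ℕ} (A : Matrix n) (girth : GirthAbove 5 (Edge A)) where

  open BipartiteGraph (graph A) using (Pair; IsEdge; Joined; VertexDisjoint; IsMatching; IsInduced)

  avoid-lr : ∀ {x y i j} → i ≢ x ⊎ j ≢ y → ¬ Link {V = Vertex n} (inj₁ x) (inj₂ y) (inj₁ i) (inj₂ j)
  avoid-lr (inj₁ i≢x) (inj₁ (refl , _)) = i≢x refl
  avoid-lr (inj₂ j≢y) (inj₁ (_ , refl)) = j≢y refl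

  avoid-rl : ∀ {x y i j} → i ≢ x ⊎ j ≢ y → ¬ Link {V = Vertex n} (inj₁ x) (inj₂ y) (inj₂ j) (inj₁ i)
  avoid-rl (inj₁ i≢x) (inj₂ (_ , refl)) = i≢x refl
  avoid-rl (inj₂ j≢y) (inj₂ (refl , _)) = j≢y refl

  no-4-cycle : ∀ {u₁ u₂ v₁ v₂} → u₁ ≢ u₂ → v₁ ≢ v₂ →
               IsEdge (u₁ , v₁) → IsEdge (u₁ , v₂) → IsEdge (u₂ , v₁) → ¬ IsEdge (u₂ , v₂)
  no-4-cycle u₁≢u₂ v₁≢v₂ e₁₁ e₁₂ e₂₁ e₂₂ = girth (lr e₁₁)
    (step (lr e₁₂ , avoid-lr (inj₂ (v₁≢v₂ ∘ sym)))
    (step (rl e₂₂ , avoid-rl (inj₁ (u₁≢u₂ ∘ sym)))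
    (step (lr e₂₁ , avoid-lr (inj₁ (u₁≢u₂ ∘ sym))) here)))

  -- The three inequalities keep the other five edges off `u₁ v₁`, as `GirthAbove` demands of the
  -- walk.
  no-6-cycle : ∀ {u₁ u₂ u₃ v₁ v₂ v₃} → u₁ ≢ u₂ → u₁ ≢ u₃ → v₁ ≢ v₂ →
               IsEdge (u₁ , v₁) → IsEdge (u₁ , v₂) → IsEdge (u₂ , v₂) →
               IsEdge (u₂ , v₃) → IsEdge (u₃ , v₃) → ¬ IsEdge (u₃ , v₁)
  no-6-cycle u₁≢u₂ u₁≢u₃ v₁≢v₂ e₁₁ e₁₂ e₂₂ e₂₃ e₃₃ e₃₁ = girth (lr e₁₁)
    (step (lr e₁₂ , avoid-lr (inj₂ (v₁≢v₂ ∘ sym)))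
    (step (rl e₂₂ , avoid-rl (inj₁ (u₁≢u₂ ∘ sym)))
    (step (lr e₂₃ , avoid-lr (inj₁ (u₁≢u₂ ∘ sym)))
    (step (rl e₃₃ , avoid-rl (inj₁ (u₁≢u₃ ∘ sym)))
    (step (lr e₃₁ , avoid-lr (inj₁ (u₁≢u₃ ∘ sym))) here)))))

  -- The choices of joining edges orient the triangle. A cyclic orientation gives a 6-cycle
  -- alternating with `e`, `f`, `g`; in a transitive one the three joining edges and one edge of the
  -- matching form a 4-cycle.
  no-triangle : ∀ {e f g : Pair} → IsEdge e → IsEdge f → IsEdge g →
                VertexDisjoint e f → VertexDisjoint e g → VertexDisjoint f g →
                Joined e f → Joined e g → ¬ Joined f g
  no-triangle e f g (u₁₂ , v₁₂) (u₁₃ , v₁₃) (u₂₃ , v₂₃) = λ where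
    (inj₁ a) (inj₁ b) (inj₁ c) → no-4-cycle u₁₂ v₂₃ a b f c
    (inj₁ a) (inj₁ b) (inj₂ c) → no-4-cycle u₁₃ v₂₃ a b c g
    (inj₁ a) (inj₂ b) (inj₁ c) → no-6-cycle u₁₂ u₁₃ v₁₂ e a f c g b
    (inj₁ a) (inj₂ b) (inj₂ c) → no-4-cycle u₁₃ v₁₂ e a b c
    (inj₂ a) (inj₁ b) (inj₁ c) → no-4-cycle u₁₂ v₁₃ e b a c
    (inj₂ a) (inj₁ b) (inj₂ c) → no-6-cycle u₁₃ u₁₂ v₁₃ e b g c f a
    (inj₂ a) (inj₂ b) (inj₁ c) → no-4-cycle u₂₃ v₁₃ a c b g
    (inj₂ a) (inj₂ b) (inj₂ c) → no-4-cycle u₂₃ v₁₂ a f b c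

  same : Pair → Pair → Bool
  same e f = does (Product.≡-dec _≟_ _≟_ e f)

  -- The first factor is there because every edge is joined to itself.
  conflict : Pair → Pair → Bool
  conflict e@(u , v) f@(u′ , v′) = not (same e f) ∧ (A u v′ ∨ A u′ v)

  same-refl : ∀ e → same e e ≡ true
  same-refl e = dec-true (Product.≡-dec _≟_ _≟_ e e) refl

  same-≢ : ∀ {e f} → e ≢ f → same e f ≡ false
  same-≢ {e} {f} = dec-false (Product.≡-dec _≟_ _≟_ e f)

  same-sym : ∀ e f → same e f ≡ same f e
  same-sym e f with Product.≡-dec _≟_ _≟_ e f
  ... | yes refl = sym (same-refl e)
  ... | no e≢f   = sym (same-≢ (e≢f ∘ sym))

  conflict-sym : ∀ e f → conflict e f ≡ conflict f e
  conflict-sym e@(u , v) f@(u′ , v′) = cong₂ (λ b c → not b ∧ c) (same-sym e f) (∨-comm (A u v′) (A u′ v))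

  conflict⇒ : ∀ {e f} → conflict e f ≡ true → e ≢ f × Joined e f
  conflict⇒ {e} {f} c with Product.≡-dec _≟_ _≟_ e f
  ... | no e≢f = e≢f , Equivalence.to T-∨ (Equivalence.from T-≡ c)

  conflict⇐ : ∀ {e f} → e ≢ f → Joined e f → conflict e f ≡ true
  conflict⇐ e≢f j rewrite same-≢ e≢f = Equivalence.to T-≡ (Equivalence.from T-∨ j)

  VertexDisjoint-sym : ∀ {e f} → VertexDisjoint e f → VertexDisjoint f e
  VertexDisjoint-sym (p , q) = p ∘ sym , q ∘ sym

  conflict-triangle-free : ∀ {M} → IsMatching M → ∀ {e f g} → e ∈ M → f ∈ M → g ∈ M →
                           conflict e f ≡ true → conflict e g ≡ true → conflict f g ≡ false
  conflict-triangle-free (edges , disjoint) {e} {f} {g} e∈ f∈ g∈ ef eg with conflict f g in fg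
  ... | false = refl
  ... | true  =
    let e≢f , Jef = conflict⇒ ef
        e≢g , Jeg = conflict⇒ eg
        f≢g , Jfg = conflict⇒ fg
    in contradiction Jfg (no-triangle (All.lookup edges e∈) (All.lookup edges f∈) (All.lookup edges g∈)
         (apart e∈ f∈ e≢f) (apart e∈ g∈ e≢g) (apart f∈ g∈ f≢g) Jef Jeg)
    where
    apart : ∀ {e f} → e ∈ _ → f ∈ _ → e ≢ f → VertexDisjoint e f
    apart = AllPairs-lookup VertexDisjoint-sym disjoint

  same-distinct : ∀ {M} → IsMatching M → ∀ w → List.sum (map (λ e → ⟦ same e w ⟧) M) ≤ 1
  same-distinct (_ , disjoint) w = go disjoint
    where
    go : ∀ {M} → AllPairs VertexDisjoint M → List.sum (map (λ e → ⟦ same e w ⟧) M) ≤ 1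
    go []                     = z≤n
    go {e ∷ M} (apart ∷ rest) with Product.≡-dec _≟_ _≟_ e w
    ... | no  _    = go rest
    ... | yes refl = ≤-reflexive (cong suc (trans
      (cong List.sum (map-cong-local {g = λ _ → 0} (All.map (λ {f} (u≢ , _) → cong ⟦_⟧ (same-≢ {f} {e} λ { refl → u≢ refl })) apart))) (sum-map-0 M)))

  -- A conflict with `(a , b)` needs a left end adjacent to `b` or a right end adjacent to `a`. Ends
  -- of distinct matching edges are distinct, so each kind occurs at most `d` times.
  conflict-degree : (∀ u → rowSum A u ≡ d) → (∀ v → rowSum (flip A) v ≡ d) → ∀ {M} → IsMatching M →
                    ∀ w → List.sum (map (λ e → ⟦ conflict e w ⟧) M) ≤ d + d
  conflict-degree rows cols {M} (_ , disjoint) w@(a , b) = begin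
    List.sum (map (λ e → ⟦ conflict e w ⟧) M)
      ≤⟨ sum-map-mono (λ (u , v) → split (not (same (u , v) w)) (A u b) (A a v)) M ⟩
    List.sum (map (λ (u , v) → ⟦ A u b ⟧ + ⟦ A a v ⟧) M)
      ≡⟨ sum-map-+ _ _ M ⟩
    List.sum (map (λ (u , _) → ⟦ A u b ⟧) M) + List.sum (map (λ (_ , v) → ⟦ A a v ⟧) M)
      ≡⟨ cong₂ _+_ (cong List.sum (map-∘ M)) (cong List.sum (map-∘ M)) ⟩
    List.sum (map (λ u → ⟦ A u b ⟧) (map proj₁ M)) + List.sum (map (λ v → ⟦ A a v ⟧) (map proj₂ M))
      ≤⟨ +-mono-≤ (sum-distinct _ (AllPairs.map⁺ (AllPairs.map proj₁ disjoint)))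
                  (sum-distinct _ (AllPairs.map⁺ (AllPairs.map proj₂ disjoint))) ⟩
    rowSum (flip A) b + rowSum A a
      ≡⟨ cong₂ _+_ (cols b) (rows a) ⟩
    d + d ∎
    where
    open ≤-Reasoning
    split : ∀ x y z → ⟦ x ∧ (y ∨ z) ⟧ ≤ ⟦ y ⟧ + ⟦ z ⟧
    split false y     z = z≤n
    split true  true  z = s≤s z≤n
    split true  false z = ≤-refl

  open Independent conflict conflict-sym

  indep⇒AllPairs : ∀ {W} → indep W ≡ true → AllPairs (λ e f → conflict e f ≡ false) W
  indep⇒AllPairs {[]}    _ = []
  indep⇒AllPairs {w ∷ W} i with free w W in free-w
  ... | true = free⇒All free-w ∷ indep⇒AllPairs i
    where
    free⇒All : ∀ {S} → free w S ≡ true → All (λ s → conflict w s ≡ false) S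
    free⇒All {[]}    _ = []
    free⇒All {s ∷ S} f with conflict w s in ws
    ... | false = ws ∷ free⇒All f

  indep⇒IsInduced : ∀ {W} → indep W ≡ true → IsInduced W
  indep⇒IsInduced {W} i {e} {f} e∈ f∈ e≢f joined
    with () ← trans (sym (conflict⇐ e≢f joined))
                (AllPairs-lookup (λ {e} {f} → trans (conflict-sym f e)) (indep⇒AllPairs i) e∈ f∈ e≢f)

  -- An independent set of conflicts-free edges of `M` is an induced submatching. The conditions on
  -- `D` serve `local-bound` and the degree bound.
  induced-submatching : (∀ u → rowSum A u ≡ d) → (∀ v → rowSum (flip A) v ≡ d) →
    ∀ D L → L * 2 ^ (2 * L) + L ≤ D → d + d ≤ D → ∀ M → IsMatching M →
    ∃[ M′ ] M′ ⊑ M × IsMatching M′ × IsInduced M′ × length M * L ≤ length M′ * (D + D)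
  induced-submatching rows cols D L L≤D 2d≤D M matching@(edges , disjoint) =
    let W , W⊑M , indep-W , large =
          large-independent same same-refl D L L≤D M (conflict-triangle-free matching)
            (λ w → ≤-trans (conflict-degree rows cols matching w) 2d≤D) (same-distinct matching)
    in W , W⊑M , (All-resp-⊆ W⊑M edges , AllPairs-resp-⊑ W⊑M disjoint) , indep⇒IsInduced indep-W , large

-- Logarithms, rational arithmetic and the choice of constants.

log₈ : ∀ d → ∃[ k ] 8 ^ k ≤ suc d × suc d < 8 ^ suc k
log₈ zero    = 0 , ≤-refl , s≤s (s≤s z≤n)
log₈ (suc d) with log₈ d
... | k , lo , hi with suc (suc d) <? 8 ^ suc k
...   | yes lt = k , m≤n⇒m≤1+n lo , lt
...   | no  ge = suc k , ≮⇒≥ ge , ≤-<-trans hi (^-monoʳ-< 8 (s≤s (s≤s z≤n)) (n<1+n (suc k)))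

-- Both `L ≤ 4 ^ L` and `suc L ≤ 2 ^ L` are used, the power of 4 being written as `2 ^ (2 * L)`.
L4^L+L≤8^L : ∀ L → L * 2 ^ (2 * L) + L ≤ 8 ^ L
L4^L+L≤8^L L = begin
  L * 2 ^ (2 * L) + L               ≤⟨ +-monoʳ-≤ _ (≤-trans (<⇒≤ (n<2^n L)) (^-monoʳ-≤ 2 (m≤m+n L _))) ⟩
  L * 2 ^ (2 * L) + 2 ^ (2 * L)     ≡⟨ +-comm _ (2 ^ (2 * L)) ⟩
  suc L * 2 ^ (2 * L)               ≤⟨ *-monoˡ-≤ (2 ^ (2 * L)) (n<2^n L) ⟩
  2 ^ L * 2 ^ (2 * L)               ≡⟨ sym (^-distribˡ-+-* 2 L (2 * L)) ⟩
  2 ^ (3 * L)                       ≡⟨ sym (^-*-assoc 2 3 L) ⟩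
  8 ^ L                             ∎
  where
  open ≤-Reasoning

fraction : (a b : ℕ) .{{_ : NonZero b}} → ℚ
fraction a b = ℤ.+ a ℚ./ b

toℚᵘ-fraction : ∀ a b → toℚᵘ (fraction a (suc b)) ≃ mkℚᵘ (ℤ.+ a) b
toℚᵘ-fraction a b = ℚ.toℚᵘ-fromℚᵘ (mkℚᵘ (ℤ.+ a) b)

1/48 : ℚ
1/48 = fraction 1 48

-- The product has the shape of the bound in `_≥_·log₂_/self`, which then follows by monotonicity.
ratio : ℕ → (d : ℕ) .{{_ : NonZero d}} → ℚ
ratio ℓ d = 1/48 ℚ.* (fraction ℓ 1 ℚ.* fraction 1 d)

-- `mkℚᵘ` takes the denominator minus one, here that of `48 * suc d`.
toℚᵘ-ratio : ∀ ℓ d → toℚᵘ (ratio ℓ (suc d)) ≃ mkℚᵘ (ℤ.+ ℓ) (d + 47 * suc d)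
toℚᵘ-ratio ℓ d = begin-equality
  toℚᵘ (ratio ℓ (suc d))
    ≃⟨ ℚ.toℚᵘ-homo-* 1/48 (fraction ℓ 1 ℚ.* fraction 1 (suc d)) ⟩
  toℚᵘ 1/48 ℚᵘ.* toℚᵘ (fraction ℓ 1 ℚ.* fraction 1 (suc d))
    ≃⟨ ℚᵘ.*-congˡ {toℚᵘ 1/48} (ℚ.toℚᵘ-homo-* (fraction ℓ 1) (fraction 1 (suc d))) ⟩
  toℚᵘ 1/48 ℚᵘ.* (toℚᵘ (fraction ℓ 1) ℚᵘ.* toℚᵘ (fraction 1 (suc d)))
    ≃⟨ ℚᵘ.*-congˡ {toℚᵘ 1/48} (ℚᵘ.*-cong (toℚᵘ-fraction ℓ 0) (toℚᵘ-fraction 1 d)) ⟩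
  mkℚᵘ (ℤ.+ 1) 47 ℚᵘ.* (mkℚᵘ (ℤ.+ ℓ) 0 ℚᵘ.* mkℚᵘ (ℤ.+ 1) d)
    ≃⟨ ℚᵘ.*≡* (cong₂ ℤ._*_ (trans (ℤ.*-identityˡ _) (ℤ.*-identityʳ (ℤ.+ ℓ)))
         (cong ℤ.+_ (denominators d))) ⟩
  mkℚᵘ (ℤ.+ ℓ) (d + 47 * suc d) ∎
  where
  open ℚᵘ.≤-Reasoning
  denominators : ∀ d → suc (d + 47 * suc d) ≡ 48 * (1 * suc d)
  denominators = solve-∀

ratio-positive : ∀ {ℓ} d → 0 < ℓ → 0ℚ ℚ.< ratio ℓ (suc d)
ratio-positive {ℓ} d 0<ℓ = ℚ.toℚᵘ-cancel-< (ℚᵘ.<-respʳ-≃ (ℚᵘ.≃-sym (toℚᵘ-ratio ℓ d))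
  (*<* (subst (ℤ.+ 0 ℤ.<_) (sym (ℤ.*-identityʳ (ℤ.+ ℓ))) (ℤ.+<+ 0<ℓ))))

ratio-≤1 : ∀ {ℓ} d → ℓ ≤ 48 * suc d → ratio ℓ (suc d) ℚ.≤ 1ℚ
ratio-≤1 {ℓ} d ℓ≤ = ℚ.toℚᵘ-cancel-≤ (ℚᵘ.≤-respˡ-≃ (ℚᵘ.≃-sym (toℚᵘ-ratio ℓ d))
  (*≤* (subst₂ ℤ._≤_ (sym (ℤ.*-identityʳ (ℤ.+ ℓ))) (sym (ℤ.*-identityˡ _)) (ℤ.+≤+ ℓ≤))))

ratio-*-≤ : ∀ ℓ d m k → ℓ * m ≤ k * (48 * suc d) → ratio ℓ (suc d) ℚ.* fraction m 1 ℚ.≤ fraction k 1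
ratio-*-≤ ℓ d m k bound = ℚ.toℚᵘ-cancel-≤ (begin
  toℚᵘ (ratio ℓ (suc d) ℚ.* fraction m 1)
    ≃⟨ ℚ.toℚᵘ-homo-* (ratio ℓ (suc d)) (fraction m 1) ⟩
  toℚᵘ (ratio ℓ (suc d)) ℚᵘ.* toℚᵘ (fraction m 1)
    ≃⟨ ℚᵘ.*-cong (toℚᵘ-ratio ℓ d) (toℚᵘ-fraction m 0) ⟩
  mkℚᵘ (ℤ.+ ℓ) (d + 47 * suc d) ℚᵘ.* mkℚᵘ (ℤ.+ m) 0
    ≤⟨ *≤* (subst₂ ℤ._≤_ (trans (ℤ.pos-* ℓ m) (sym (ℤ.*-identityʳ (ℤ.+ ℓ ℤ.* ℤ.+ m))))
         (trans (cong (λ z → ℤ.+ (k * z)) (sym (*-identityʳ _))) (ℤ.pos-* k _)) (ℤ.+≤+ bound)) ⟩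
  mkℚᵘ (ℤ.+ k) 0
    ≃⟨ ℚᵘ.≃-sym (toℚᵘ-fraction k 0) ⟩
  toℚᵘ (fraction k 1) ∎)
  where open ℚᵘ.≤-Reasoning

-- If `r` is `a / b` with `a` nonnegative, then `2 ^ a ≤ d ^ b ≤ 2 ^ (3 * L * b)` forces
-- `a ≤ 3 * L * b`; a negative `r` is below the bound anyway.
≤log₂-bound : ∀ {d} L → d < 8 ^ L → ∀ r → r ≤log₂ d → r ℚ.≤ fraction (3 * L) 1
≤log₂-bound {d} L d<8^L r r≤ = ℚ.toℚᵘ-cancel-≤ (ℚᵘ.≤-respʳ-≃ (ℚᵘ.≃-sym (toℚᵘ-fraction (3 * L) 0)) (numerators r r≤))
  where
  numerators : ∀ r → r ≤log₂ d → toℚᵘ r ℚᵘ.≤ mkℚᵘ (ℤ.+ (3 * L)) 0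
  numerators (mkℚ ℤ.-[1+ a ] b-1 _) _  = *≤* (subst (_ ℤ.≤_) (ℤ.pos-* (3 * L) (suc b-1)) ℤ.-≤+)
  numerators (mkℚ (ℤ.+ a) b-1 _) 2^a≤d^b =
    *≤* (subst₂ ℤ._≤_ (sym (ℤ.*-identityʳ (ℤ.+ a))) (ℤ.pos-* (3 * L) (suc b-1)) (ℤ.+≤+ (≮⇒≥ too-large)))
    where
    b = suc b-1
    too-large : ¬ 3 * L * b < a
    too-large lt = <⇒≱ (^-monoʳ-< 2 (s≤s (s≤s z≤n)) lt) (begin
      2 ^ a             ≤⟨ 2^a≤d^b ⟩
      d ^ b             ≤⟨ ^-monoˡ-≤ b (<⇒≤ d<8^L) ⟩
      (8 ^ L) ^ b       ≡⟨ cong (_^ b) (^-*-assoc 2 3 L) ⟩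
      (2 ^ (3 * L)) ^ b ≡⟨ ^-*-assoc 2 (3 * L) b ⟩
      2 ^ (3 * L * b)   ∎)
      where open ≤-Reasoning

multitaskers : (d : ℕ) .{{_ : NonZero d}} →
  ∃[ N ] ∀ (n : ℕ) → n ≥ N →
  Σ[ G ∈ BipartiteGraph n ] Regular G d ×
  (∃[ α ] 0ℚ ℚ.< α × α ℚ.≤ 1ℚ × IsMultitasker G α × α ≥ 1/48 ·log₂ d /self)
multitaskers (suc d) = suc (ballSize (suc d) 6 + ballSize (suc d) 6) , λ n large →
  let A , girth , rows , cols = regular-of-large-girth large
      k , 8^k≤d , d<8^L = log₈ d
      -- Rounding up makes `3 * L` a bound for the binary logarithm, while `8 ^ L` is still at most
      -- eight times the degree, whence `D = 8 * suc d`. The guaranteed fraction, `L` over `2 * D`,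
      -- is `3 * L` over `48 * suc d`.
      L = suc k
      8^L≤8d = *-monoʳ-≤ 8 8^k≤d
      α = ratio (3 * L) (suc d)
  in graph A
   , ( (λ u → trans (∣tabulate∣≡sum (A u)) (rows u))
     , (λ v → trans (∣tabulate∣≡sum (flip A v)) (cols v)))
   , α
   , ratio-positive {3 * L} d (s≤s z≤n)
   , ratio-≤1 d (≤-trans (*-monoʳ-≤ 3 (≤-trans (m≤n+m L (L * 2 ^ (2 * L))) (≤-trans (L4^L+L≤8^L L) 8^L≤8d)))
                         (≤-trans (m≤m+n _ (24 * suc d)) (≤-reflexive (48d (suc d)))))
   , (λ M matching →
        let M′ , M′⊑M , matching′ , induced , long =
              induced-submatching A girth rows cols (8 * suc d) L (≤-trans (L4^L+L≤8^L L) 8^L≤8d)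
                (≤-trans (m≤m+n _ (6 * suc d)) (≤-reflexive (8d (suc d)))) M matching
        in M′ , lookup M′⊑M , matching′ , induced ,
           ratio-*-≤ (3 * L) d (length M) (length M′)
             (≤-trans (≤-reflexive (left L (length M)))
               (≤-trans (*-monoʳ-≤ 3 long) (≤-reflexive (right (length M′) (suc d))))))
   , λ r r≤ → ℚ.*-monoˡ-≤-nonNeg 1/48
       (ℚ.*-monoʳ-≤-nonNeg (fraction 1 (suc d)) {{ℚ.normalize-nonNeg 1 (suc d)}} (≤log₂-bound L d<8^L r r≤))
  where
  48d : ∀ d → 3 * (8 * d) + 24 * d ≡ 48 * d
  48d = solve-∀
  8d : ∀ d → (d + d) + 6 * d ≡ 8 * d
  8d = solve-∀
  left : ∀ l m → 3 * l * m ≡ 3 * (m * l)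
  left = solve-∀
  right : ∀ m d → 3 * (m * (8 * d + 8 * d)) ≡ m * (48 * d)
  right = solve-∀

theorem4p9 : ∃[ c ] 0ℚ ℚ.< c ×
    (∀ (d : ℕ) .{{_ : NonZero d}} →
    ∃[ N ] ∀ (n : ℕ) → n ≥ N →
    Σ[ G ∈ BipartiteGraph n ] Regular G d ×
    (∃[ α ] 0ℚ ℚ.< α × α ℚ.≤ 1ℚ × IsMultitasker G α × α ≥ c ·log₂ d /self))
theorem4p9 = 1/48 , ℚ.positive⁻¹ 1/48 , multitaskers
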